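{- Let $G$ be a cograph. Then $G$ is well-equi-hued if and only if its complement $\overline{G}$ is well-equi-hued.
   Context: All graphs are finite and simple. For $k\ge 1$, a maximal $k$-colorable subgraph of $G$ is a subgraph induced by a set $S\subseteq V(G)$ such that $G[S]$ is (properly) $k$-colorable and $G[S']$ is not $k$-colorable for every $S'$ with $S\subsetneq S'\subseteq V(G)$. $G$ is well-hued if for every $k\ge 1$ all maximal $k$-colorable subgraphs of $G$ have the same order, denoted $a_k$. A graph $G$ of order $n$ with chromatic number $\chi$ is well-equi-hued if it is well-hued and $a_i=\frac{i}{\chi}n$ for all $i\in\{1,\dots,\chi\}$. Cographs are the smallest class of graphs containing the one-vertex graph $K_1$ and closed under disjoint unions and joins (the join $G\vee H$ is the disjoint union of $G$ and $H$ together with all edges between $V(G)$ and $V(H)$). -}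

module Defs where

open import Data.Empty using (⊥)
open import Data.Fin.Base using (Fin; splitAt)
open import Data.Fin.Properties using (_≟_)
open import Data.Fin.Subset using (Subset; _∈_; _⊂_; ∣_∣)
open import Data.Nat.Base using (ℕ; _+_; _*_; _≤_)
open import Data.Product using (Σ-syntax; ∃-syntax; _×_; _,_; proj₁)
open import Data.Sum.Base using (_⊎_; inj₁; inj₂)
open import Data.Sum.Relation.Binary.Pointwise using (Pointwise; inj₁; inj₂; ⊎-symmetric; ⊎-decidable)
open import Data.Unit.Base using (tt)
open import Function.Base using (_∘_; _on_)
open import Function.Bundles using (_↔_; _⇔_; Inverse)
open import Level using (0ℓ)
open import Relation.Binary.Core using (Rel)
open import Relation.Binary.Definitions using (Symmetric; Decidable)
open import Relation.Binary.PropositionalEquality using (_≡_; _≢_; refl; ≢-sym)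
open import Relation.Nullary using (¬_; yes; no; ¬?; _×-dec_)
open import Relation.Nullary.Decidable using (map′)

-- Adjacency is required to be decidable so that, constructively, a graph is
-- nothing more than a 0/1 adjacency matrix.
record Graph : Set₁ where
  field
    order      : ℕ
    Adj        : Rel (Fin order) 0ℓ
    adj?       : Decidable Adj
    adj-sym    : Symmetric Adj
    adj-irrefl : ∀ v → ¬ Adj v v

  Vertex : Set
  Vertex = Fin order

open Graph

infix 4 _≅_

_≅_ : Graph → Graph → Set
G ≅ H = Σ[ f ∈ Vertex G ↔ Vertex H ]
          (∀ u v → Adj G u v ⇔ Adj H (Inverse.to f u) (Inverse.to f v))

complement : Graph → Graph
complement G = record
  { order      = order G
  ; Adj        = λ u v → u ≢ v × ¬ Adj G u v
  ; adj?       = λ u v → ¬? (u ≟ v) ×-dec ¬? (adj? G u v)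
  ; adj-sym    = λ (u≢v , ¬uv) → ≢-sym u≢v , ¬uv ∘ adj-sym G
  ; adj-irrefl = λ v (v≢v , _) → v≢v refl
  }

K₁ : Graph
K₁ = record
  { order      = 1
  ; Adj        = λ _ _ → ⊥
  ; adj?       = λ _ _ → no λ()
  ; adj-sym    = λ ()
  ; adj-irrefl = λ _ ()
  }

data JoinAdj {A B : Set} (R : Rel A 0ℓ) (S : Rel B 0ℓ) : Rel (A ⊎ B) 0ℓ where
  left   : ∀ {a a′} → R a a′ → JoinAdj R S (inj₁ a) (inj₁ a′)
  right  : ∀ {b b′} → S b b′ → JoinAdj R S (inj₂ b) (inj₂ b′)
  cross  : ∀ {a b} → JoinAdj R S (inj₁ a) (inj₂ b)
  cross′ : ∀ {a b} → JoinAdj R S (inj₂ b) (inj₁ a)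

module _ {A B : Set} {R : Rel A 0ℓ} {S : Rel B 0ℓ} where

  joinAdj-sym : Symmetric R → Symmetric S → Symmetric (JoinAdj R S)
  joinAdj-sym symR symS (left r)  = left (symR r)
  joinAdj-sym symR symS (right s) = right (symS s)
  joinAdj-sym symR symS cross     = cross′
  joinAdj-sym symR symS cross′    = cross

  joinAdj? : Decidable R → Decidable S → Decidable (JoinAdj R S)
  joinAdj? R? S? (inj₁ a) (inj₁ a′) = map′ left (λ { (left r) → r }) (R? a a′)
  joinAdj? R? S? (inj₁ a) (inj₂ b)  = yes cross
  joinAdj? R? S? (inj₂ b) (inj₁ a)  = yes cross′
  joinAdj? R? S? (inj₂ b) (inj₂ b′) = map′ right (λ { (right s) → s }) (S? b b′)

  joinAdj-irrefl : (∀ a → ¬ R a a) → (∀ b → ¬ S b b) → ∀ x → ¬ JoinAdj R S x x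
  joinAdj-irrefl irrR irrS (inj₁ a) (left r)  = irrR a r
  joinAdj-irrefl irrR irrS (inj₂ b) (right s) = irrS b s

  pointwise-irrefl : (∀ a → ¬ R a a) → (∀ b → ¬ S b b) → ∀ x → ¬ Pointwise R S x x
  pointwise-irrefl irrR irrS (inj₁ a) (inj₁ r) = irrR a r
  pointwise-irrefl irrR irrS (inj₂ b) (inj₂ s) = irrS b s

infixr 6 _∪ᴳ_ _∨ᴳ_

_∪ᴳ_ : Graph → Graph → Graph
G ∪ᴳ H = record
  { order      = order G + order H
  ; Adj        = Pointwise (Adj G) (Adj H) on splitAt (order G)
  ; adj?       = λ u v → ⊎-decidable (adj? G) (adj? H) (split u) (split v)
  ; adj-sym    = ⊎-symmetric (adj-sym G) (adj-sym H)
  ; adj-irrefl = pointwise-irrefl (adj-irrefl G) (adj-irrefl H) ∘ split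
  }
  where
  split : Fin (order G + order H) → Vertex G ⊎ Vertex H
  split = splitAt (order G)

_∨ᴳ_ : Graph → Graph → Graph
G ∨ᴳ H = record
  { order      = order G + order H
  ; Adj        = JoinAdj (Adj G) (Adj H) on splitAt (order G)
  ; adj?       = λ u v → joinAdj? (adj? G) (adj? H) (split u) (split v)
  ; adj-sym    = joinAdj-sym (adj-sym G) (adj-sym H)
  ; adj-irrefl = joinAdj-irrefl (adj-irrefl G) (adj-irrefl H) ∘ split
  }
  where
  split : Fin (order G + order H) → Vertex G ⊎ Vertex H
  split = splitAt (order G)

-- Classes of graphs are closed under isomorphism; since vertices are labelled
-- by Fin n, this has to be a constructor.
data Cograph : Graph → Set₁ where
  k₁    : Cograph K₁
  union : ∀ {G H} → Cograph G → Cograph H → Cograph (G ∪ᴳ H)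
  join  : ∀ {G H} → Cograph G → Cograph H → Cograph (G ∨ᴳ H)
  iso   : ∀ {G H} → G ≅ H → Cograph G → Cograph H

-- Stated for a relation on an arbitrary vertex type, so that it applies both
-- to a graph and to its induced subgraphs.
Colorable : ℕ → {V : Set} → Rel V 0ℓ → Set
Colorable k {V} E = Σ[ c ∈ (V → Fin k) ] (∀ u v → E u v → c u ≢ c v)

-- The adjacency relation of the induced subgraph G[S], whose vertices are
-- the members of S.
_[_] : (G : Graph) (S : Subset (order G)) → Rel (∃[ v ] v ∈ S) 0ℓ
G [ S ] = Adj G on proj₁

IsMaximalColorable : (G : Graph) → ℕ → Subset (order G) → Set
IsMaximalColorable G k S =
  Colorable k (G [ S ]) × (∀ S′ → S ⊂ S′ → ¬ Colorable k (G [ S′ ]))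

WellHued : Graph → Set
WellHued G = ∀ k → 1 ≤ k → ∀ S T →
  IsMaximalColorable G k S → IsMaximalColorable G k T → ∣ S ∣ ≡ ∣ T ∣

IsChromaticNumber : Graph → ℕ → Set
IsChromaticNumber G χ = Colorable χ (Adj G) × (∀ k → Colorable k (Adj G) → χ ≤ k)

-- The common order aᵢ is the order of any maximal i-colorable subgraph, and
-- aᵢ = (i / χ) n is written with the denominator cleared; i ranges over
-- 1, …, χ, so χ is positive wherever the equation is asserted.
WellEquiHued : Graph → Set
WellEquiHued G = WellHued G × ∃[ χ ] (IsChromaticNumber G χ ×
  (∀ i → 1 ≤ i → i ≤ χ → ∀ S → IsMaximalColorable G i S → χ * ∣ S ∣ ≡ i * order G))

-- Call G uniform with parameters p, q if it has order p q, is p-colorable, and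
-- all its maximal k-colorable sets have k q vertices for k ≤ p; for graphs with
-- a vertex this is the well-equi-hued property with χ = p.  A disjoint union is
-- (p, q)-uniform iff its parts are (p, q₁)- and (p, q₂)-uniform with q₁ + q₂ = q,
-- and a join is (p, q)-uniform iff its parts are (p₁, q)- and (p₂, q)-uniform
-- with p₁ + p₂ = p.  Complementation exchanges unions with joins, so by induction
-- over the cograph it exchanges p and q.
module Submission where

open import Defs
open import Data.Bool.Base using (if_then_else_)
open import Data.Empty using (⊥-elim)
open import Data.Fin.Base
  using (Fin; zero; suc; toℕ; fromℕ<; splitAt; _↑ˡ_; _↑ʳ_; funToFin; finToFun)
  renaming (join to joinFin)
open import Data.Fin.Permutation using (↔⇒≡)
open import Data.Fin.Properties
  using (any?; all?; toℕ<n; toℕ-injective; toℕ-fromℕ<; fromℕ<-injective; finToFun-funToFin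
        ; splitAt-↑ˡ; splitAt-↑ʳ; splitAt-join; join-splitAt; suc-injective)
open import Data.Fin.Subset
  using (Subset; inside; outside; _∈_; _∉_; _⊆_; _⊃_; ∣_∣; _∪_; _-_; ⁅_⁆; ⊤; ⊥)
open import Data.Fin.Subset.Induction using (⊃-wellFounded; Acc; acc)
open import Data.Fin.Subset.Properties
  using (_∈?_; ∈⊤; ⊆⊤; ∉⊥; ∣⊤∣≡n; ∣⊥∣≡0; p⊆q⇒∣p∣≤∣q∣; ⊆-refl; ⊆-antisym; x∈⁅x⁆; x∈⁅y⁆⇒x≡y
        ; x∈p∪q⁺; x∈p∪q⁻; x∈p∧x≢y⇒x∈p-y; x∈p⇒∣p-x∣<∣p∣)
open import Data.Nat.Base
open import Data.Nat.Properties hiding (suc-injective)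
import Data.Nat.Properties as ℕ
open import Algebra.Properties.CommutativeSemigroup *-commutativeSemigroup using (x∙yz≈y∙xz)
open import Data.Product.Base using (Σ-syntax; ∃; ∃-syntax; ∃₂; _×_; _,_; proj₁; proj₂)
open import Data.Sum.Base using (_⊎_; inj₁; inj₂; [_,_]′; swap)
open import Data.Sum.Properties using (swap-involutive; inj₁-injective; inj₂-injective)
open import Data.Sum.Relation.Binary.Pointwise using (Pointwise; inj₁; inj₂)
open import Data.Vec.Base using ([]; _∷_; _++_; tabulate)
import Data.Vec.Base as Vec
open import Data.Vec.Properties using (lookup-splitAt; lookup∘tabulate; lookup⇒[]=; []=⇒lookup)
open import Function.Base using (_∘_; id; _on_)
open import Function.Bundles using (_⇔_; mk⇔; mk↔ₛ′; Inverse; Equivalence)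
open import Function.Construct.Identity using (↔-id)
open import Function.Construct.Symmetry using (↔-sym)
open import Function.Definitions using (Injective)
open import Level using (0ℓ)
open import Relation.Binary.Core using (Rel)
open import Relation.Binary.Definitions using (tri<; tri≈; tri>)
open import Relation.Binary.PropositionalEquality
open import Relation.Nullary using (¬_; Dec; yes; no; does; contradiction; _×-dec_; _→-dec_; ¬?)
open import Relation.Nullary.Decidable using (map′; decidable-stable; dec-true)
open import Relation.Unary using (Pred; Decidable)

open Graph

-- The colourable sets of a graph are never compared with those of its complement; all depends on
-- how a budget of `k` colours behaves under the two operations. In a union both parts draw on the
-- same `k` colours independently, but uniformity controls only the sum of the two sizes, and the
-- summands have to be recovered from it. In a join the budget splits as `i + j`, and the split may
-- be wasteful: a side can hold more colours than its chromatic number, a range in which its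
-- uniformity says nothing about sizes.

private
  variable
    i j k m n p q : ℕ
    V W : Set

-- Sizes, comprehension and concatenation of finite subsets

-- Turns sizes known only as a sum over the two parts of a union into sizes for each part.
m+n≡p+q⇒m≡p : ∀ {m n p q} → m ≤ p → n ≤ q → m + n ≡ p + q → m ≡ p
m+n≡p+q⇒m≡p {m} {n} {p} {q} m≤p n≤q eq = ≤-antisym m≤p (+-cancelʳ-≤ n p m (begin
  p + n ≤⟨ +-monoʳ-≤ p n≤q ⟩
  p + q ≡⟨ eq ⟨
  m + n ∎))
  where open ≤-Reasoning

m+n≡p+q⇒n≡q : ∀ {m n p q} → m ≤ p → n ≤ q → m + n ≡ p + q → n ≡ q
m+n≡p+q⇒n≡q {m} {n} {p} {q} m≤p n≤q eq =
  m+n≡p+q⇒m≡p n≤q m≤p (trans (+-comm n m) (trans eq (+-comm p q)))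

∣p∪q∣≤∣p∣+∣q∣ : ∀ (p q : Subset n) → ∣ p ∪ q ∣ ≤ ∣ p ∣ + ∣ q ∣
∣p∪q∣≤∣p∣+∣q∣ []            []            = z≤n
∣p∪q∣≤∣p∣+∣q∣ (outside ∷ p) (outside ∷ q) = ∣p∪q∣≤∣p∣+∣q∣ p q
∣p∪q∣≤∣p∣+∣q∣ (outside ∷ p) (inside ∷ q)  =
  ≤-trans (s≤s (∣p∪q∣≤∣p∣+∣q∣ p q)) (≤-reflexive (sym (+-suc ∣ p ∣ ∣ q ∣)))
∣p∪q∣≤∣p∣+∣q∣ (inside ∷ p)  (outside ∷ q) = s≤s (∣p∪q∣≤∣p∣+∣q∣ p q)
∣p∪q∣≤∣p∣+∣q∣ (inside ∷ p)  (inside ∷ q)  =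
  s≤s (≤-trans (∣p∪q∣≤∣p∣+∣q∣ p q) (+-monoʳ-≤ ∣ p ∣ (n≤1+n ∣ q ∣)))

∣p++q∣≡∣p∣+∣q∣ : ∀ (p : Subset m) (q : Subset n) → ∣ p ++ q ∣ ≡ ∣ p ∣ + ∣ q ∣
∣p++q∣≡∣p∣+∣q∣ []            q = refl
∣p++q∣≡∣p∣+∣q∣ (outside ∷ p) q = ∣p++q∣≡∣p∣+∣q∣ p q
∣p++q∣≡∣p∣+∣q∣ (inside ∷ p)  q = cong suc (∣p++q∣≡∣p∣+∣q∣ p q)

injective⇒∣p∣≤∣q∣ : ∀ {f : Fin m → Fin n} → Injective _≡_ _≡_ f → (p : Subset m) (q : Subset n) →
                    (∀ v → v ∈ p → f v ∈ q) → ∣ p ∣ ≤ ∣ q ∣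
injective⇒∣p∣≤∣q∣         inj []            q f∈ = z≤n
injective⇒∣p∣≤∣q∣         inj (outside ∷ p) q f∈ =
  injective⇒∣p∣≤∣q∣ (suc-injective ∘ inj) p q (λ v → f∈ (suc v) ∘ Vec.there)
-- The image of the first element is removed from `q`; injectivity keeps the other images in what
-- remains.
injective⇒∣p∣≤∣q∣ {f = f} inj (inside ∷ p)  q f∈ = ≤-<-trans
  (injective⇒∣p∣≤∣q∣ (suc-injective ∘ inj) p (q - f zero)
    (λ v v∈p → x∈p∧x≢y⇒x∈p-y (f∈ (suc v) (Vec.there v∈p)) (λ eq → contradiction (inj eq) λ ())))
  (x∈p⇒∣p-x∣<∣p∣ (f∈ zero Vec.here))

subset : {P : Pred (Fin n) 0ℓ} → Decidable P → Subset n
subset P? = tabulate (does ∘ P?)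

module _ {P : Pred (Fin n) 0ℓ} (P? : Decidable P) where

  ∈-subset⁺ : ∀ {v} → P v → v ∈ subset P?
  ∈-subset⁺ {v} Pv = lookup⇒[]= v _ (trans (lookup∘tabulate _ v) (dec-true (P? v) Pv))

  ∈-subset⁻ : ∀ {v} → v ∈ subset P? → P v
  ∈-subset⁻ {v} v∈ with P? v | trans (sym (lookup∘tabulate (does ∘ P?) v)) ([]=⇒lookup v∈)
  ... | yes Pv | _  = Pv
  ... | no _   | ()

module _ (S : Subset m) (T : Subset n) where

  ∈-++⁻ : ∀ {v} → v ∈ S ++ T → [ _∈ S , _∈ T ]′ (splitAt m v)
  ∈-++⁻ {v} v∈ with splitAt m v | trans (sym (lookup-splitAt m S T v)) ([]=⇒lookup v∈)
  ... | inj₁ a | eq = lookup⇒[]= a S eq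
  ... | inj₂ b | eq = lookup⇒[]= b T eq

  ∈-++⁺ : ∀ {v} → [ _∈ S , _∈ T ]′ (splitAt m v) → v ∈ S ++ T
  ∈-++⁺ {v} v∈ with splitAt m v | lookup-splitAt m S T v
  ... | inj₁ a | eq = lookup⇒[]= v (S ++ T) (trans eq ([]=⇒lookup v∈))
  ... | inj₂ b | eq = lookup⇒[]= v (S ++ T) (trans eq ([]=⇒lookup v∈))

  ∈-++⁺ˡ : ∀ {a} → a ∈ S → a ↑ˡ n ∈ S ++ T
  ∈-++⁺ˡ {a} a∈S = ∈-++⁺ (subst [ _∈ S , _∈ T ]′ (sym (splitAt-↑ˡ m a n)) a∈S)

  ∈-++⁺ʳ : ∀ {b} → b ∈ T → m ↑ʳ b ∈ S ++ T
  ∈-++⁺ʳ {b} b∈T = ∈-++⁺ (subst [ _∈ S , _∈ T ]′ (sym (splitAt-↑ʳ m n b)) b∈T)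

  ∈-++⁻ˡ : ∀ {a} → a ↑ˡ n ∈ S ++ T → a ∈ S
  ∈-++⁻ˡ {a} a∈ = subst [ _∈ S , _∈ T ]′ (splitAt-↑ˡ m a n) (∈-++⁻ a∈)

  ∈-++⁻ʳ : ∀ {b} → m ↑ʳ b ∈ S ++ T → b ∈ T
  ∈-++⁻ʳ {b} b∈ = subst [ _∈ S , _∈ T ]′ (splitAt-↑ʳ m n b) (∈-++⁻ b∈)

module _ {S S′ : Subset m} {T T′ : Subset n} where

  ++-mono-⊆ : S ⊆ S′ → T ⊆ T′ → S ++ T ⊆ S′ ++ T′
  ++-mono-⊆ S⊆ T⊆ {v} v∈ = ∈-++⁺ S′ T′ (side (splitAt m v) (∈-++⁻ S T v∈))
    where
    side : ∀ x → [ _∈ S , _∈ T ]′ x → [ _∈ S′ , _∈ T′ ]′ x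
    side (inj₁ a) = S⊆
    side (inj₂ b) = T⊆

  ++-⊆⁻ˡ : S ++ T ⊆ S′ ++ T′ → S ⊆ S′
  ++-⊆⁻ˡ ⊆ a∈ = ∈-++⁻ˡ S′ T′ (⊆ (∈-++⁺ˡ S T a∈))

  ++-⊆⁻ʳ : S ++ T ⊆ S′ ++ T′ → T ⊆ T′
  ++-⊆⁻ʳ ⊆ b∈ = ∈-++⁻ʳ S′ T′ (⊆ (∈-++⁺ʳ S T b∈))

⊤⊆⊤++⊤ : ⊤ ⊆ ⊤ {m} ++ ⊤ {n}
⊤⊆⊤++⊤ {m} {n} {v} _ = ∈-++⁺ (⊤ {m}) ⊤ (side (splitAt m v))
  where
  side : ∀ x → [ _∈ ⊤ {m} , _∈ ⊤ {n} ]′ x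
  side (inj₁ a) = ∈⊤
  side (inj₂ b) = ∈⊤

-- Colourings relative to a predicate

-- Colourings of an induced subgraph are total on the ambient vertices, so that
-- restricting the vertex set or raising k leaves the function unchanged.
ColorableOn : ℕ → Rel V 0ℓ → Pred V 0ℓ → Set
ColorableOn {V} k R P = Σ[ c ∈ (V → ℕ) ]
  (∀ v → P v → c v < k) × (∀ u v → P u → P v → R u v → c u ≢ c v)

module _ {R : Rel V 0ℓ} {R′ : Rel W 0ℓ} {P : Pred V 0ℓ} {P′ : Pred W 0ℓ} where

  pullback : (f : V → W) → (∀ {u v} → R u v → R′ (f u) (f v)) → (∀ {v} → P v → P′ (f v)) →
             ColorableOn k R′ P′ → ColorableOn k R P
  pullback f f-adj f-in (c , c<k , proper) =
    c ∘ f , (λ v → c<k (f v) ∘ f-in) ,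
    (λ u v Pu Pv → proper (f u) (f v) (f-in Pu) (f-in Pv) ∘ f-adj)

module _ {R : Rel V 0ℓ} where

  restrict : {P P′ : Pred V 0ℓ} → (∀ {v} → P v → P′ v) → ColorableOn k R P′ → ColorableOn k R P
  restrict = pullback id id

  weaken : {P : Pred V 0ℓ} → j ≤ k → ColorableOn j R P → ColorableOn k R P
  weaken j≤k (c , c<j , proper) = c , (λ v Pv → <-≤-trans (c<j v Pv) j≤k) , proper

  colorable⇒colorableOn : {P : Pred V 0ℓ} → Decidable P →
                          Colorable k {∃ P} (R on proj₁) → ColorableOn k R P
  colorable⇒colorableOn {k} {P} P? (c , proper) = c′ , c′<k , proper′
    where
    c′ : V → ℕ
    c′ v with P? v
    ... | yes Pv = toℕ (c (v , Pv))
    -- An arbitrary default: nothing is demanded outside `P`.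
    ... | no _   = 0

    c′<k : ∀ v → P v → c′ v < k
    c′<k v Pv with P? v
    ... | yes Pv′ = toℕ<n (c (v , Pv′))
    ... | no ¬Pv  = contradiction Pv ¬Pv

    proper′ : ∀ u v → P u → P v → R u v → c′ u ≢ c′ v
    proper′ u v Pu Pv Ruv with P? u | P? v
    ... | yes Pu′ | yes Pv′ = proper (u , Pu′) (v , Pv′) Ruv ∘ toℕ-injective
    ... | no ¬Pu  | _       = contradiction Pu ¬Pu
    ... | _       | no ¬Pv  = contradiction Pv ¬Pv

  colorableOn⇒colorable : {P : Pred V 0ℓ} → ColorableOn k R P → Colorable k {∃ P} (R on proj₁)
  colorableOn⇒colorable (c , c<k , proper) =
    (λ (v , Pv) → fromℕ< (c<k v Pv)) ,
    (λ (u , Pu) (v , Pv) Ruv → proper u v Pu Pv Ruv ∘ fromℕ<-injective (c u) (c v) _ _)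

-- Renumbering the colours in use

module _ {P : Pred ℕ 0ℓ} (P? : Decidable P) where

  -- The number of `x < m` that satisfy `P`; on `P` it is the order-preserving renumbering onto an
  -- initial segment.
  rank : ℕ → ℕ
  rank zero    = 0
  rank (suc m) = if does (P? m) then suc (rank m) else rank m

  rank-≤-suc : ∀ m → rank m ≤ rank (suc m)
  rank-≤-suc m with P? m
  ... | yes _ = n≤1+n (rank m)
  ... | no _  = ≤-refl

  rank-mono-≤ : m ≤′ n → rank m ≤ rank n
  rank-mono-≤ ≤′-refl           = ≤-refl
  rank-mono-≤ (≤′-step {n} m≤n) = ≤-trans (rank-mono-≤ m≤n) (rank-≤-suc n)

  rank-<-suc : P m → rank m < rank (suc m)
  rank-<-suc {m} Pm with P? m
  ... | yes _  = ≤-refl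
  ... | no ¬Pm = contradiction Pm ¬Pm

  rank-mono-< : P m → m < n → rank m < rank n
  rank-mono-< Pm m<n = <-≤-trans (rank-<-suc Pm) (rank-mono-≤ (≤⇒≤′ m<n))

  rank-injective : P m → P n → rank m ≡ rank n → m ≡ n
  rank-injective {m} {n} Pm Pn eq with ℕ.<-cmp m n
  ... | tri< m<n _ _ = contradiction eq (<⇒≢ (rank-mono-< Pm m<n))
  ... | tri≈ _ m≡n _ = m≡n
  ... | tri> _ _ n<m = contradiction (sym eq) (<⇒≢ (rank-mono-< Pn n<m))

rank-disjoint : {P Q : Pred ℕ 0ℓ} (P? : Decidable P) (Q? : Decidable Q) →
                (∀ {m} → P m → ¬ Q m) → ∀ k → rank P? k + rank Q? k ≤ k
rank-disjoint P? Q? P∩Q=∅ zero    = z≤n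
rank-disjoint P? Q? P∩Q=∅ (suc k) with P? k | Q? k | rank-disjoint P? Q? P∩Q=∅ k
... | yes Pk | yes Qk | _  = contradiction Qk (P∩Q=∅ Pk)
... | yes _  | no _   | ih = s≤s ih
... | no _   | yes _  | ih = ≤-trans (≤-reflexive (+-suc _ _)) (s≤s ih)
... | no _   | no _   | ih = m≤n⇒m≤1+n ih

-- `rank` is strictly increasing on used colours, so distinct ones stay distinct. It frees the
-- colours that one side of a join does not use.
compress : {R : Rel V 0ℓ} {P : Pred V 0ℓ} → (colouring : ColorableOn k R P) →
           (used? : Decidable (λ x → ∃[ v ] P v × proj₁ colouring v ≡ x)) →
           ColorableOn (rank used? k) R P
compress (c , c<k , proper) used? =
  rank used? ∘ c ,
  (λ v Pv → rank-mono-< used? (v , Pv , refl) (c<k v Pv)) ,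
  (λ u v Pu Pv Ruv → proper u v Pu Pv Ruv ∘ rank-injective used? (u , Pu , refl) (v , Pv , refl))

-- Maximal colourable sets

module _ (G : Graph) where

  ColorableSet : ℕ → Subset (order G) → Set
  ColorableSet k S = ColorableOn k (Adj G) (_∈ S)

  -- A positive form of maximality, free of strict inclusion and negation; it agrees with
  -- `IsMaximalColorable` because membership is decidable.
  Maximal : ℕ → Subset (order G) → Set
  Maximal k S = ColorableSet k S × (∀ T → S ⊆ T → ColorableSet k T → T ⊆ S)

module _ (G : Graph) where

  colorableSet? : ∀ k S → Dec (ColorableSet G k S)
  colorableSet? k S = map′ found search (any? λ x → proper? (toℕ ∘ finToFun x))
    where
    Proper : (Vertex G → ℕ) → Set
    Proper c = (∀ v → v ∈ S → c v < k) × (∀ u v → u ∈ S → v ∈ S → Adj G u v → c u ≢ c v)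

    proper? : ∀ c → Dec (Proper c)
    proper? c =
      all? (λ v → v ∈? S →-dec c v <? k) ×-dec
      all? (λ u → all? λ v → u ∈? S →-dec v ∈? S →-dec adj? G u v →-dec ¬? (c u ℕ.≟ c v))

    found : (∃[ x ] Proper (toℕ ∘ finToFun {suc k} {order G} x)) → ColorableSet G k S
    found (x , proper) = _ , proper

    search : ColorableSet G k S → ∃[ x ] Proper (toℕ ∘ finToFun {suc k} {order G} x)
    search (c , c<k , proper) = funToFin f ,
      (λ v v∈S → subst (_< k) (sym (f≡c v∈S)) (c<k v v∈S)) ,
      (λ u v u∈S v∈S uv eq → proper u v u∈S v∈S uv (trans (sym (f≡c u∈S)) (trans eq (f≡c v∈S))))
      where
      f : Vertex G → Fin (suc k)
      -- Truncation at `k` changes nothing on `S`. The extra colour `k` leaves a value for the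
      -- vertices outside `S`, even when `k` is 0.
      f v = fromℕ< (s≤s (m⊓n≤n (c v) k))

      f≡c : ∀ {v} → v ∈ S → toℕ (finToFun (funToFin f) v) ≡ c v
      f≡c {v} v∈S = trans (cong toℕ (finToFun-funToFin f v))
        (trans (toℕ-fromℕ< _) (m≤n⇒m⊓n≡m (<⇒≤ (c<k v v∈S))))

  extend : ∀ {S} → ColorableSet G k S → ∃[ M ] S ⊆ M × Maximal G k M
  extend {k} {S} = go (⊃-wellFounded S)
    where
    go : ∀ {S} → Acc _⊃_ S → ColorableSet G k S → ∃[ M ] S ⊆ M × Maximal G k M
    go {S} (acc larger) colS
      with any? (λ v → ¬? (v ∈? S) ×-dec colorableSet? k (S ∪ ⁅ v ⁆))
    ... | yes (v , v∉S , col) =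
      let M , ⊆M , max = go (larger (x∈p∪q⁺ ∘ inj₁ , v , x∈p∪q⁺ (inj₂ (x∈⁅x⁆ v)) , v∉S)) col
      in M , ⊆M ∘ x∈p∪q⁺ ∘ inj₁ , max
    -- Testing single vertices suffices: a vertex `v` of a colourable `T ⊇ S` outside `S` would make
    -- `S ∪ ⁅ v ⁆` colourable as a subset of `T`.
    ... | no none = S , ⊆-refl , colS , λ T S⊆T colT {v} v∈T →
      decidable-stable (v ∈? S) λ v∉S → none (v , v∉S , restrict
        (λ {u} u∈ → [ S⊆T , (λ u∈⁅v⁆ → subst (_∈ T) (sym (x∈⁅y⁆⇒x≡y v u∈⁅v⁆)) v∈T) ]′
          (x∈p∪q⁻ S ⁅ v ⁆ u∈)) colT)

  colorable-⊥ : ColorableSet G 0 ⊥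
  colorable-⊥ = (λ _ → 0) , (λ _ → ⊥-elim ∘ ∉⊥) , (λ _ _ → ⊥-elim ∘ ∉⊥)

  extend-⊥ : ∀ k → ∃[ M ] Maximal G k M
  extend-⊥ k =
    let M , _ , max = extend {k} (weaken z≤n colorable-⊥)
    in M , max

  maximal⇒≡⊤ : ∀ {S} → Maximal G k S → ColorableSet G k ⊤ → S ≡ ⊤
  maximal⇒≡⊤ (_ , max) col = ⊆-antisym ⊆⊤ (max ⊤ ⊆⊤ col)

  maximal-⊤ : ColorableSet G k ⊤ → Maximal G k ⊤
  maximal-⊤ col = col , λ _ _ _ → ⊆⊤

  -- Within `S ∪ ⁅ v ⁆` only `v` can receive the fresh colour `k`, so an edge inside that colour
  -- would be a loop.
  add-vertex : ∀ {S} v → ColorableSet G k S → ColorableSet G (suc k) (S ∪ ⁅ v ⁆)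
  add-vertex {k} {S} v (c , c<k , proper) = c′ , c′<1+k , proper′
    where
    c′ : Vertex G → ℕ
    c′ u with u ∈? S
    ... | yes _ = c u
    ... | no _  = k

    c′<1+k : ∀ u → u ∈ S ∪ ⁅ v ⁆ → c′ u < suc k
    c′<1+k u _ with u ∈? S
    ... | yes u∈S = m<n⇒m<1+n (c<k u u∈S)
    ... | no _    = ≤-refl

    new : ∀ {u} → u ∈ S ∪ ⁅ v ⁆ → u ∉ S → u ≡ v
    new {u} u∈ u∉S = [ (λ u∈S → contradiction u∈S u∉S) , x∈⁅y⁆⇒x≡y v ]′ (x∈p∪q⁻ S ⁅ v ⁆ u∈)

    proper′ : ∀ u w → u ∈ S ∪ ⁅ v ⁆ → w ∈ S ∪ ⁅ v ⁆ → Adj G u w → c′ u ≢ c′ w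
    proper′ u w u∈ w∈ uw with u ∈? S | w ∈? S
    ... | yes u∈S | yes w∈S = proper u w u∈S w∈S uw
    ... | yes u∈S | no _    = <⇒≢ (c<k u u∈S)
    ... | no _    | yes w∈S = ≢-sym (<⇒≢ (c<k w w∈S))
    ... | no u∉S  | no w∉S  with new u∈ u∉S | new w∈ w∉S
    ...   | refl | refl = contradiction uw (adj-irrefl G u)

  -- With fewer colours in use, a fresh one would allow adding any vertex.
  maximal-needs-all-colors : ∀ {S} → (∀ {j} → ColorableSet G j ⊤ → p ≤ j) →
                             k ≤ p → Maximal G k S → ColorableSet G j S → k ≤ j
  maximal-needs-all-colors {S = S} min k≤p (_ , max) col = ≮⇒≥ λ j<k →
    -- Absorbing every vertex makes `S` the whole graph, now coloured with `j < k ≤ p` colours,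
    -- against `min`.
    <-irrefl refl (<-≤-trans j<k (≤-trans k≤p (min (restrict (λ {v} _ →
      max (S ∪ ⁅ v ⁆) (x∈p∪q⁺ ∘ inj₁) (weaken j<k (add-vertex v col)) (x∈p∪q⁺ (inj₂ (x∈⁅x⁆ v)))) col))))

  colorable-0⇒⊆ : ∀ {S T} → ColorableSet G 0 S → S ⊆ T
  colorable-0⇒⊆ (_ , c<0 , _) {v} v∈S = contradiction (c<0 v v∈S) λ ()

  -- Each colour class is independent; the induction splits off the class of the last colour.
  ∣colorable∣≤ : (∀ I → ColorableSet G 1 I → ∣ I ∣ ≤ q) →
                 ∀ k S → ColorableSet G k S → ∣ S ∣ ≤ k * q
  ∣colorable∣≤     bound zero    S col =
    ≤-trans (p⊆q⇒∣p∣≤∣q∣ (colorable-0⇒⊆ {T = ⊥} col)) (≤-reflexive (∣⊥∣≡0 (order G)))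
  ∣colorable∣≤ {q} bound (suc k) S (c , c≤k , proper) = begin
    ∣ S ∣                ≤⟨ p⊆q⇒∣p∣≤∣q∣ S⊆last∪rest ⟩
    ∣ last ∪ rest ∣      ≤⟨ ∣p∪q∣≤∣p∣+∣q∣ last rest ⟩
    ∣ last ∣ + ∣ rest ∣  ≤⟨ +-mono-≤ (bound last col-last) (∣colorable∣≤ bound k rest col-rest) ⟩
    q + k * q            ∎
    where
    open ≤-Reasoning

    last? : Decidable (λ v → v ∈ S × c v ≡ k)
    last? v = v ∈? S ×-dec c v ℕ.≟ k

    rest? : Decidable (λ v → v ∈ S × c v < k)
    rest? v = v ∈? S ×-dec c v <? k

    last rest : Subset (order G)
    last = subset last?
    rest = subset rest?

    S⊆last∪rest : S ⊆ last ∪ rest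
    S⊆last∪rest {v} v∈S with c v ℕ.≟ k
    ... | yes c≡k = x∈p∪q⁺ (inj₁ (∈-subset⁺ last? (v∈S , c≡k)))
    ... | no c≢k  = x∈p∪q⁺ (inj₂ (∈-subset⁺ rest? (v∈S , ≤∧≢⇒< (s≤s⁻¹ (c≤k v v∈S)) c≢k)))

    col-last : ColorableSet G 1 last
    col-last = (λ _ → 0) , (λ _ _ → z<s) , λ u v u∈ v∈ uv _ →
      let u∈S , cu≡k = ∈-subset⁻ last? u∈
          v∈S , cv≡k = ∈-subset⁻ last? v∈
      in proper u v u∈S v∈S uv (trans cu≡k (sym cv≡k))

    col-rest : ColorableSet G k rest
    col-rest = c , (λ v → proj₂ ∘ ∈-subset⁻ rest?) , λ u v u∈ v∈ →
      proper u v (proj₁ (∈-subset⁻ rest? u∈)) (proj₁ (∈-subset⁻ rest? v∈))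

  colorable⇒colorableSet-⊤ : Colorable k (Adj G) → ColorableSet G k ⊤
  colorable⇒colorableSet-⊤ (c , proper) =
    toℕ ∘ c , (λ v _ → toℕ<n (c v)) , λ u v _ _ uv → proper u v uv ∘ toℕ-injective

  colorableSet-⊤⇒colorable : ColorableSet G k ⊤ → Colorable k (Adj G)
  colorableSet-⊤⇒colorable (c , c<k , proper) =
    (λ v → fromℕ< (c<k v ∈⊤)) , λ u v uv → proper u v ∈⊤ ∈⊤ uv ∘ fromℕ<-injective (c u) (c v) _ _

  maximal⇒isMaximalColorable : ∀ {S} → Maximal G k S → IsMaximalColorable G k S
  maximal⇒isMaximalColorable {S = S} (col , max) =
    colorableOn⇒colorable col ,
    λ T (S⊆T , v , v∈T , v∉S) colT → v∉S (max T S⊆T (colorable⇒colorableOn (_∈? T) colT) v∈T)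

  isMaximalColorable⇒maximal : ∀ {S} → IsMaximalColorable G k S → Maximal G k S
  isMaximalColorable⇒maximal {S = S} (col , max) =
    colorable⇒colorableOn (_∈? S) col ,
    λ T S⊆T colT {v} v∈T → decidable-stable (v ∈? S)
      λ v∉S → max T (S⊆T , v , v∈T , v∉S) (colorableOn⇒colorable colT)

-- Uniform graphs and the well-equi-hued property

-- G has chromatic number p and independence number q, and a_k = k q for k ≤ p.
record Uniform (G : Graph) (p q : ℕ) : Set where
  constructor uniform
  field
    order≡     : order G ≡ p * q
    colorable  : ColorableSet G p ⊤
    ∣maximal∣≡ : ∀ k S → k ≤ p → Maximal G k S → ∣ S ∣ ≡ k * q

open Uniform

-- If `k < p`, the whole vertex set would be a maximal `k`-colourable set, so that `k * q ≡ p * q`;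
-- a vertex makes `q` nonzero and cancellable.
uniform⇒minimal : ∀ {G} → 0 < order G → Uniform G p q → ColorableSet G k ⊤ → p ≤ k
uniform⇒minimal {p} {q} {k} {G} 0<n (uniform n≡pq _ ∣max∣) col = ≮⇒≥ λ k<p →
  <⇒≢ k<p (*-cancelʳ-≡ k p q (begin
    k * q    ≡⟨ ∣max∣ k ⊤ (<⇒≤ k<p) (maximal-⊤ G col) ⟨
    ∣ ⊤ {order G} ∣ ≡⟨ ∣⊤∣≡n (order G) ⟩
    order G  ≡⟨ n≡pq ⟩
    p * q    ∎))
  where
  open ≡-Reasoning
  instance
    q≢0 : NonZero q
    q≢0 = m*n≢0⇒n≢0 p {{>-nonZero (subst (0 <_) n≡pq 0<n)}}

0<order⇒0<colors : ∀ {G} → 0 < order G → Uniform G p q → 0 < p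
0<order⇒0<colors {p} {q} 0<n u =
  >-nonZero⁻¹ p {{m*n≢0⇒m≢0 p {{>-nonZero (subst (0 <_) (order≡ u) 0<n)}}}}

wellEquiHued⇒uniform : ∀ G → 0 < order G → WellEquiHued G → ∃₂ λ p q → Uniform G p q
wellEquiHued⇒uniform G 0<n (_ , χ , (colχ , _) , equi) =
  χ , α , uniform n≡χα (colorable⇒colorableSet-⊤ G colχ) sizes
  where
  open ≡-Reasoning

  0<χ : 0 < χ
  0<χ = ≤-<-trans z≤n (toℕ<n (proj₁ colχ (fromℕ< 0<n)))

  instance
    χ≢0 : NonZero χ
    χ≢0 = >-nonZero 0<χ

  α : ℕ
  -- Any maximal independent set will do: the equation for `i = 1` reads `χ * α ≡ order G`.
  α = ∣ proj₁ (extend-⊥ G 1) ∣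

  n≡χα : order G ≡ χ * α
  n≡χα = sym (trans
    (equi 1 ≤-refl 0<χ _ (maximal⇒isMaximalColorable G (proj₂ (extend-⊥ G 1))))
    (*-identityˡ (order G)))

  sizes : ∀ k S → k ≤ χ → Maximal G k S → ∣ S ∣ ≡ k * α
  -- Uniformity includes `k = 0`, where the well-equi-hued equations are silent; only the empty set
  -- is 0-colourable.
  sizes zero    S _   (col , _) = n≤0⇒n≡0
    (≤-trans (p⊆q⇒∣p∣≤∣q∣ (colorable-0⇒⊆ G {T = ⊥} col)) (≤-reflexive (∣⊥∣≡0 (order G))))
  sizes k@(suc _) S k≤χ max = *-cancelˡ-≡ ∣ S ∣ (k * α) χ (begin
    χ * ∣ S ∣    ≡⟨ equi k z<s k≤χ S (maximal⇒isMaximalColorable G max) ⟩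
    k * order G  ≡⟨ cong (k *_) n≡χα ⟩
    k * (χ * α)  ≡⟨ x∙yz≈y∙xz k χ α ⟩
    χ * (k * α)  ∎)

uniform⇒wellEquiHued : ∀ {G} → 0 < order G → Uniform G p q → WellEquiHued G
uniform⇒wellEquiHued {p} {q} {G} 0<n u@(uniform n≡pq colp ∣max∣) =
  wellHued , p ,
  (colorableSet-⊤⇒colorable G colp , λ k → uniform⇒minimal 0<n u ∘ colorable⇒colorableSet-⊤ G) ,
  equi
  where
  open ≡-Reasoning

  wellHued : WellHued G
  wellHued k _ S T maxS maxT with k ≤? p
  ... | yes k≤p = trans (∣max∣ k S k≤p (isMaximalColorable⇒maximal G maxS))
                    (sym (∣max∣ k T k≤p (isMaximalColorable⇒maximal G maxT)))
  -- From `p` colours on, the whole vertex set is the only maximal set.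
  ... | no k≰p  = cong ∣_∣ (trans (maximal⇒≡⊤ G (isMaximalColorable⇒maximal G maxS) colk)
                    (sym (maximal⇒≡⊤ G (isMaximalColorable⇒maximal G maxT) colk)))
    where
    colk : ColorableSet G k ⊤
    colk = weaken (≰⇒≥ k≰p) colp

  equi : ∀ k → 1 ≤ k → k ≤ p → ∀ S → IsMaximalColorable G k S → p * ∣ S ∣ ≡ k * order G
  equi k _ k≤p S max = begin
    p * ∣ S ∣    ≡⟨ cong (p *_) (∣max∣ k S k≤p (isMaximalColorable⇒maximal G max)) ⟩
    p * (k * q)  ≡⟨ x∙yz≈y∙xz p k q ⟩
    k * (p * q)  ≡⟨ cong (k *_) n≡pq ⟨
    k * order G  ∎

-- Invariance under isomorphism

≅-sym : ∀ G H → G ≅ H → H ≅ G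
≅-sym G H (f , adj) = ↔-sym f , λ u v →
  let module E = Equivalence (adj (from u) (from v)) in mk⇔
    (λ uv → E.from (subst₂ (Adj H) (sym (inverseˡ refl)) (sym (inverseˡ refl)) uv))
    (λ uv → subst₂ (Adj H) (inverseˡ refl) (inverseˡ refl) (E.to uv))
  where open Inverse f

uniform-≅ : ∀ G H → G ≅ H → Uniform G p q → Uniform H p q
uniform-≅ {p} {q} G H G≅H@(f , adj) (uniform n≡pq colp ∣max∣) = uniform
  (trans (sym (↔⇒≡ f)) n≡pq)
  (pullback from from-adj (λ _ → ∈⊤) colp)
  sizes
  where
  open Inverse f

  to-adj : ∀ {u v} → Adj G u v → Adj H (to u) (to v)
  to-adj {u} {v} = Equivalence.to (adj u v)

  from-adj : ∀ {u v} → Adj H u v → Adj G (from u) (from v)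
  from-adj {u} {v} = Equivalence.to (proj₂ (≅-sym G H G≅H) u v)

  to-from : ∀ {v} → to (from v) ≡ v
  to-from = inverseˡ refl

  from-to : ∀ {v} → from (to v) ≡ v
  from-to = inverseʳ refl

  sizes : ∀ k S → k ≤ p → Maximal H k S → ∣ S ∣ ≡ k * q
  sizes k S k≤p (col , max) = trans
    -- `from` and `to` inject `S` and its preimage `S₀` into each other.
    (≤-antisym
      (injective⇒∣p∣≤∣q∣ {f = from} (λ eq → trans (sym to-from) (trans (cong to eq) to-from)) S S₀
        (λ v v∈S → ∈-subset⁺ in-S? (subst (_∈ S) (sym to-from) v∈S)))
      (injective⇒∣p∣≤∣q∣ {f = to} (λ eq → trans (sym from-to) (trans (cong from eq) from-to)) S₀ S
        (λ v → ∈-subset⁻ in-S?)))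
    (∣max∣ k S₀ k≤p (pullback to to-adj (∈-subset⁻ in-S?) col , max₀))
    where
    in-S? : Decidable (λ v → to v ∈ S)
    in-S? v = to v ∈? S

    S₀ : Subset (order G)
    S₀ = subset in-S?

    max₀ : ∀ T → S₀ ⊆ T → ColorableSet G k T → T ⊆ S₀
    max₀ T S₀⊆T colT {v} v∈T = ∈-subset⁺ in-S?
      (max (subset in-T?)
        (λ {w} w∈S → ∈-subset⁺ in-T? (S₀⊆T (∈-subset⁺ in-S? (subst (_∈ S) (sym to-from) w∈S))))
        (pullback from from-adj (∈-subset⁻ in-T?) colT)
        (∈-subset⁺ in-T? (subst (_∈ T) (sym from-to) v∈T)))
      where
      in-T? : Decidable (λ w → from w ∈ T)
      in-T? w = from w ∈? T

-- Disjoint unions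

module _ (G H : Graph) where

  ∪ᴳ-colorable⁺ : ∀ {S T} → ColorableSet G k S → ColorableSet H k T →
                  ColorableSet (G ∪ᴳ H) k (S ++ T)
  ∪ᴳ-colorable⁺ {k} {S} {T} (c , c<k , proper-c) (d , d<k , proper-d) =
    restrict {P′ = [ _∈ S , _∈ T ]′ ∘ splitAt (order G)} (∈-++⁻ S T)
      (pullback (splitAt (order G)) id id ([ c , d ]′ , cd<k , proper))
    where
    cd<k : ∀ x → [ _∈ S , _∈ T ]′ x → [ c , d ]′ x < k
    cd<k (inj₁ a) = c<k a
    cd<k (inj₂ b) = d<k b

    proper : ∀ x y → [ _∈ S , _∈ T ]′ x → [ _∈ S , _∈ T ]′ y →
             Pointwise (Adj G) (Adj H) x y → [ c , d ]′ x ≢ [ c , d ]′ y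
    proper (inj₁ a) (inj₁ a′) a∈ a′∈ (inj₁ aa′) = proper-c a a′ a∈ a′∈ aa′
    proper (inj₂ b) (inj₂ b′) b∈ b′∈ (inj₂ bb′) = proper-d b b′ b∈ b′∈ bb′

  ∪ᴳ-colorable⁻ : ∀ S T → ColorableSet (G ∪ᴳ H) k (S ++ T) → ColorableSet G k S × ColorableSet H k T
  ∪ᴳ-colorable⁻ S T col =
    pullback (_↑ˡ order H)
      (λ {u} {v} uv → subst₂ (Pointwise (Adj G) (Adj H))
        (sym (splitAt-↑ˡ _ u _)) (sym (splitAt-↑ˡ _ v _)) (inj₁ uv))
      (∈-++⁺ˡ S T) col ,
    pullback (order G ↑ʳ_)
      (λ {u} {v} uv → subst₂ (Pointwise (Adj G) (Adj H))
        (sym (splitAt-↑ʳ (order G) _ u)) (sym (splitAt-↑ʳ (order G) _ v)) (inj₂ uv))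
      (∈-++⁺ʳ S T) col

  -- The parts share one palette without interacting, so maximality can be tested in each part
  -- separately.
  ∪ᴳ-maximal⁺ : ∀ {S T} → Maximal G k S → Maximal H k T → Maximal (G ∪ᴳ H) k (S ++ T)
  ∪ᴳ-maximal⁺ {k} {S} {T} (colS , maxS) (colT , maxT) = ∪ᴳ-colorable⁺ colS colT , max
    where
    max : ∀ U → S ++ T ⊆ U → ColorableSet (G ∪ᴳ H) k U → U ⊆ S ++ T
    max U ⊆U colU with Vec.splitAt (order G) U
    ... | S′ , T′ , refl =
      let colS′ , colT′ = ∪ᴳ-colorable⁻ S′ T′ colU
      in ++-mono-⊆ (maxS S′ (++-⊆⁻ˡ {T = T} {T′} ⊆U) colS′) (maxT T′ (++-⊆⁻ʳ {S = S} {S′} ⊆U) colT′)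

  ∪ᴳ-maximal⁻ : ∀ {S T} → Maximal (G ∪ᴳ H) k (S ++ T) → Maximal G k S × Maximal H k T
  ∪ᴳ-maximal⁻ {S = S} {T} (col , max) =
    let colS , colT = ∪ᴳ-colorable⁻ S T col in
    (colS , λ S′ S⊆S′ colS′ → ++-⊆⁻ˡ {T = T} {T}
      (max (S′ ++ T) (++-mono-⊆ {T = T} S⊆S′ id) (∪ᴳ-colorable⁺ colS′ colT))) ,
    (colT , λ T′ T⊆T′ colT′ → ++-⊆⁻ʳ {S = S} {S}
      (max (S ++ T′) (++-mono-⊆ {S = S} id T⊆T′) (∪ᴳ-colorable⁺ colS colT′)))

  uniform-∪ᴳ⁺ : ∀ {q r} → Uniform G p q → Uniform H p r → Uniform (G ∪ᴳ H) p (q + r)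
  uniform-∪ᴳ⁺ {p} {q} {r} (uniform n≡pq colG ∣max∣G) (uniform n≡pr colH ∣max∣H) = uniform
    (trans (cong₂ _+_ n≡pq n≡pr) (sym (*-distribˡ-+ p q r)))
    (restrict (⊤⊆⊤++⊤ {order G}) (∪ᴳ-colorable⁺ colG colH))
    sizes
    where
    sizes : ∀ k S → k ≤ p → Maximal (G ∪ᴳ H) k S → ∣ S ∣ ≡ k * (q + r)
    sizes k U k≤p max with Vec.splitAt (order G) U
    ... | S , T , refl =
      let maxS , maxT = ∪ᴳ-maximal⁻ {S = S} {T} max in begin
      ∣ S ++ T ∣     ≡⟨ ∣p++q∣≡∣p∣+∣q∣ S T ⟩
      ∣ S ∣ + ∣ T ∣  ≡⟨ cong₂ _+_ (∣max∣G k S k≤p maxS) (∣max∣H k T k≤p maxT) ⟩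
      k * q + k * r  ≡⟨ *-distribˡ-+ k q r ⟨
      k * (q + r)    ∎
      where open ≡-Reasoning

  -- Independent sets bound the colour classes, so |S| ≤ k r and |T| ≤ k s for
  -- k-colorable S and T; the sum k (r + s) is attained, hence so are both bounds.
  uniform-∪ᴳ⁻ : 0 < order (G ∪ᴳ H) → Uniform (G ∪ᴳ H) p q →
                ∃₂ λ r s → r + s ≡ q × Uniform G p r × Uniform H p s
  uniform-∪ᴳ⁻ {p} {q} 0<n u@(uniform n≡pq colp ∣max∣) =
    r , s , r+s≡q ,
    uniform
      (m+n≡p+q⇒m≡p orderG≤ orderH≤ orders)
      colG
      -- Any maximal `T` on the other side completes `S` to a maximal set of the union, whose size
      -- is known.
      (λ k S k≤p maxS → let T , maxT = extend-⊥ H k in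
        m+n≡p+q⇒m≡p (∣G∣≤ k S (proj₁ maxS)) (∣H∣≤ k T (proj₁ maxT)) (total k k≤p maxS maxT)) ,
    uniform
      (m+n≡p+q⇒n≡q orderG≤ orderH≤ orders)
      colH
      (λ k T k≤p maxT → let S , maxS = extend-⊥ G k in
        m+n≡p+q⇒n≡q (∣G∣≤ k S (proj₁ maxS)) (∣H∣≤ k T (proj₁ maxT)) (total k k≤p maxS maxT))
    where
    A : Subset (order G)
    A = proj₁ (extend-⊥ G 1)

    B : Subset (order H)
    B = proj₁ (extend-⊥ H 1)

    maxA : Maximal G 1 A
    maxA = proj₂ (extend-⊥ G 1)

    maxB : Maximal H 1 B
    maxB = proj₂ (extend-⊥ H 1)

    r s : ℕ
    r = ∣ A ∣
    s = ∣ B ∣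

    sum-∣max∣ : ∀ k {S T} → k ≤ p → Maximal G k S → Maximal H k T → ∣ S ∣ + ∣ T ∣ ≡ k * q
    sum-∣max∣ k {S} {T} k≤p maxS maxT =
      trans (sym (∣p++q∣≡∣p∣+∣q∣ S T)) (∣max∣ k (S ++ T) k≤p (∪ᴳ-maximal⁺ maxS maxT))

    sum-∣max∣₁ : ∀ {S T} → Maximal G 1 S → Maximal H 1 T → ∣ S ∣ + ∣ T ∣ ≡ q
    sum-∣max∣₁ maxS maxT =
      -- Sizes are known only up to `p` colours, so `k = 1` needs `p` positive.
      trans (sum-∣max∣ 1 (0<order⇒0<colors 0<n u) maxS maxT) (*-identityˡ q)

    r+s≡q : r + s ≡ q
    r+s≡q = sum-∣max∣₁ maxA maxB

    ∣G∣≤ : ∀ k S → ColorableSet G k S → ∣ S ∣ ≤ k * r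
    -- Paired with the fixed `B`, every maximal independent set `M` of `G` gives the sum `q`, hence
    -- has `r` elements.
    ∣G∣≤ = ∣colorable∣≤ G λ I colI → let M , I⊆M , maxM = extend G colI in
      ≤-trans (p⊆q⇒∣p∣≤∣q∣ I⊆M)
        (≤-reflexive (+-cancelʳ-≡ s ∣ M ∣ r (trans (sum-∣max∣₁ maxM maxB) (sym r+s≡q))))

    ∣H∣≤ : ∀ k T → ColorableSet H k T → ∣ T ∣ ≤ k * s
    ∣H∣≤ = ∣colorable∣≤ H λ I colI → let M , I⊆M , maxM = extend H colI in
      ≤-trans (p⊆q⇒∣p∣≤∣q∣ I⊆M)
        (≤-reflexive (+-cancelˡ-≡ r ∣ M ∣ s (trans (sum-∣max∣₁ maxA maxM) (sym r+s≡q))))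

    k*q≡ : ∀ k → k * q ≡ k * r + k * s
    k*q≡ k = trans (cong (k *_) (sym r+s≡q)) (*-distribˡ-+ k r s)

    total : ∀ k {S T} → k ≤ p → Maximal G k S → Maximal H k T → ∣ S ∣ + ∣ T ∣ ≡ k * r + k * s
    total k k≤p maxS maxT = trans (sum-∣max∣ k k≤p maxS maxT) (k*q≡ k)

    orders : order G + order H ≡ p * r + p * s
    orders = trans n≡pq (k*q≡ p)

    colG : ColorableSet G p ⊤
    colG = proj₁ (∪ᴳ-colorable⁻ ⊤ ⊤ (restrict (λ _ → ∈⊤) colp))

    colH : ColorableSet H p ⊤
    colH = proj₂ (∪ᴳ-colorable⁻ ⊤ ⊤ (restrict (λ _ → ∈⊤) colp))

    orderG≤ : order G ≤ p * r
    orderG≤ = subst (_≤ p * r) (∣⊤∣≡n (order G)) (∣G∣≤ p ⊤ colG)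

    orderH≤ : order H ≤ p * s
    orderH≤ = subst (_≤ p * s) (∣⊤∣≡n (order H)) (∣H∣≤ p ⊤ colH)

  -- Joins

  ∨ᴳ-colorable⁺ : ∀ {S T} → ColorableSet G i S → ColorableSet H j T →
                  ColorableSet (G ∨ᴳ H) (i + j) (S ++ T)
  ∨ᴳ-colorable⁺ {i} {j} {S} {T} (c , c<i , proper-c) (d , d<j , proper-d) =
    restrict {P′ = [ _∈ S , _∈ T ]′ ∘ splitAt (order G)} (∈-++⁻ S T)
      (pullback (splitAt (order G)) id id (cd , cd<i+j , proper))
    where
    cd : Vertex G ⊎ Vertex H → ℕ
    -- All cross edges are present, so the colours of `H` are shifted past those of `G`.
    cd = [ c , (i +_) ∘ d ]′

    cd<i+j : ∀ x → [ _∈ S , _∈ T ]′ x → cd x < i + j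
    cd<i+j (inj₁ a) a∈ = <-≤-trans (c<i a a∈) (m≤m+n i j)
    cd<i+j (inj₂ b) b∈ = +-monoʳ-< i (d<j b b∈)

    c<i+d : ∀ {a} b → a ∈ S → c a < i + d b
    c<i+d {a} b a∈ = <-≤-trans (c<i a a∈) (m≤m+n i (d b))

    proper : ∀ x y → [ _∈ S , _∈ T ]′ x → [ _∈ S , _∈ T ]′ y →
             JoinAdj (Adj G) (Adj H) x y → cd x ≢ cd y
    proper (inj₁ a) (inj₁ a′) a∈ a′∈ (left aa′)  = proper-c a a′ a∈ a′∈ aa′
    proper (inj₂ b) (inj₂ b′) b∈ b′∈ (right bb′) =
      proper-d b b′ b∈ b′∈ bb′ ∘ +-cancelˡ-≡ i (d b) (d b′)
    proper (inj₁ a) (inj₂ b)  a∈ b∈  cross       = <⇒≢ (c<i+d b a∈)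
    proper (inj₂ b) (inj₁ a)  b∈ a∈  cross′      = ≢-sym (<⇒≢ (c<i+d b a∈))

  -- No colour occurs on both sides of a join.
  ∨ᴳ-colorable⁻ : ∀ S T → ColorableSet (G ∨ᴳ H) k (S ++ T) →
                  ∃₂ λ i j → i + j ≡ k × ColorableSet G i S × ColorableSet H j T
  ∨ᴳ-colorable⁻ {k} S T col@(c , _ , proper) =
    -- Colours used on neither side are credited to `G`, which makes the sum exactly `k`.
    k ∸ rank usedT? k , rank usedT? k , m∸n+n≡m (m+n≤o⇒n≤o (rank usedS? k) ranks≤k) ,
    weaken (m+n≤o⇒m≤o∸n (rank usedS? k) ranks≤k) (compress colS usedS?) , compress colT usedT?
    where
    colS : ColorableSet G k S
    colS = pullback (_↑ˡ order H)
      (λ {u} {v} uv → subst₂ (JoinAdj (Adj G) (Adj H))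
        (sym (splitAt-↑ˡ _ u _)) (sym (splitAt-↑ˡ _ v _)) (left uv))
      (∈-++⁺ˡ S T) col

    colT : ColorableSet H k T
    colT = pullback (order G ↑ʳ_)
      (λ {u} {v} uv → subst₂ (JoinAdj (Adj G) (Adj H))
        (sym (splitAt-↑ʳ (order G) _ u)) (sym (splitAt-↑ʳ (order G) _ v)) (right uv))
      (∈-++⁺ʳ S T) col

    usedS? : Decidable (λ x → ∃[ v ] v ∈ S × c (v ↑ˡ order H) ≡ x)
    usedS? x = any? λ v → v ∈? S ×-dec c (v ↑ˡ order H) ℕ.≟ x

    usedT? : Decidable (λ x → ∃[ v ] v ∈ T × c (order G ↑ʳ v) ≡ x)
    usedT? x = any? λ v → v ∈? T ×-dec c (order G ↑ʳ v) ℕ.≟ x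

    ranks≤k : rank usedS? k + rank usedT? k ≤ k
    ranks≤k = rank-disjoint usedS? usedT?
      (λ (a , a∈S , ca≡x) (b , b∈T , cb≡x) →
        proper (a ↑ˡ order H) (order G ↑ʳ b) (∈-++⁺ˡ S T a∈S) (∈-++⁺ʳ S T b∈T)
          (subst₂ (JoinAdj (Adj G) (Adj H))
            (sym (splitAt-↑ˡ _ a _)) (sym (splitAt-↑ʳ (order G) _ b)) cross)
          (trans ca≡x (sym cb≡x)))
      k

  -- Enlarging one side within its own share enlarges `S ++ T` within `i + j` colours. The converse
  -- fails: a colour idle on one side may allow growth on the other.
  ∨ᴳ-maximal⁻ : ∀ S T → ColorableSet G i S → ColorableSet H j T →
                Maximal (G ∨ᴳ H) (i + j) (S ++ T) → Maximal G i S × Maximal H j T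
  ∨ᴳ-maximal⁻ S T colS colT (_ , max) =
    (colS , λ S′ S⊆S′ colS′ → ++-⊆⁻ˡ {T = T} {T}
      (max (S′ ++ T) (++-mono-⊆ {T = T} S⊆S′ id) (∨ᴳ-colorable⁺ colS′ colT))) ,
    (colT , λ T′ T⊆T′ colT′ → ++-⊆⁻ʳ {S = S} {S}
      (max (S ++ T′) (++-mono-⊆ {S = S} id T⊆T′) (∨ᴳ-colorable⁺ colS colT′)))

  -- Unused colours can be moved to the other side until neither side has more
  -- than it needs to be coloured completely.
  balance : ∀ {S T a b} → ColorableSet G a ⊤ → ColorableSet H b ⊤ → i + j ≤ a + b →
            ColorableSet G i S → ColorableSet H j T →
            ∃₂ λ i′ j′ → i′ + j′ ≡ i + j × i′ ≤ a × j′ ≤ b ×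
                              ColorableSet G i′ S × ColorableSet H j′ T
  balance {i} {j} {a = a} {b} colG colH i+j≤a+b colS colT with i ≤? a | j ≤? b
  ... | yes i≤a | yes j≤b = i , j , refl , i≤a , j≤b , colS , colT
  ... | no i≰a  | _       = let a≤i = ≰⇒≥ i≰a in
    a , i + j ∸ a , m+[n∸m]≡n (≤-trans a≤i (m≤m+n i j)) , ≤-refl , m≤n+o⇒m∸n≤o (i + j) a i+j≤a+b ,
    restrict (λ _ → ∈⊤) colG ,
    weaken (m+n≤o⇒m≤o∸n j (≤-trans (≤-reflexive (+-comm j a)) (+-monoˡ-≤ j a≤i))) colT
  ... | yes _   | no j≰b  = let b≤j = ≰⇒≥ j≰b in
    i + j ∸ b , b , m∸n+n≡m (≤-trans b≤j (m≤n+m j i)) ,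
    m≤n+o⇒m∸n≤o (i + j) b (subst (i + j ≤_) (+-comm a b) i+j≤a+b) , ≤-refl ,
    weaken (m+n≤o⇒m≤o∸n i (+-monoʳ-≤ i b≤j)) colS ,
    restrict (λ _ → ∈⊤) colH

  uniform-∨ᴳ⁺ : ∀ {a b} → Uniform G a q → Uniform H b q → Uniform (G ∨ᴳ H) (a + b) q
  uniform-∨ᴳ⁺ {q} {a} {b} (uniform n≡aq colG ∣max∣G) (uniform n≡bq colH ∣max∣H) = uniform
    (trans (cong₂ _+_ n≡aq n≡bq) (sym (*-distribʳ-+ q a b)))
    (restrict (⊤⊆⊤++⊤ {order G}) (∨ᴳ-colorable⁺ colG colH))
    sizes
    where
    sizes : ∀ k S → k ≤ a + b → Maximal (G ∨ᴳ H) k S → ∣ S ∣ ≡ k * q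
    sizes k U k≤a+b max with Vec.splitAt (order G) U
    ... | S , T , refl with ∨ᴳ-colorable⁻ S T (proj₁ max)
    -- The shares `i₀` and `j₀` may exceed `a` or `b`, beyond the range in which the sizes in `G`
    -- and `H` are known.
    ...   | i₀ , j₀ , refl , colS₀ , colT₀ with balance colG colH k≤a+b colS₀ colT₀
    ...     | i , j , i+j≡k , i≤a , j≤b , colS , colT rewrite sym i+j≡k =
      let maxS , maxT = ∨ᴳ-maximal⁻ S T colS colT max in begin
      ∣ S ++ T ∣     ≡⟨ ∣p++q∣≡∣p∣+∣q∣ S T ⟩
      ∣ S ∣ + ∣ T ∣  ≡⟨ cong₂ _+_ (∣max∣G i S i≤a maxS) (∣max∣H j T j≤b maxT) ⟩
      i * q + j * q  ≡⟨ *-distribʳ-+ q i j ⟨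
      (i + j) * q    ∎
      where open ≡-Reasoning

  -- A maximal set of G uses all its colours, so it stays maximal in the join.
  uniform-∨ᴳ-left : ∀ {a} → ColorableSet G a ⊤ → (∀ {k} → ColorableSet G k ⊤ → a ≤ k) → a ≤ p →
                    Uniform (G ∨ᴳ H) p q → Uniform G a q
  uniform-∨ᴳ-left {p} {q} {a} colG min a≤p (uniform _ _ ∣max∣) = uniform
    -- The order is itself one of the sizes: `⊤` is maximal for `a` colours.
    (trans (sym (∣⊤∣≡n (order G))) (sizes a ⊤ ≤-refl (maximal-⊤ G colG)))
    colG
    sizes
    where
    sizes : ∀ k S → k ≤ a → Maximal G k S → ∣ S ∣ ≡ k * q
    sizes k S k≤a maxS@(colS , max) = begin
      ∣ S ∣              ≡⟨ +-identityʳ ∣ S ∣ ⟨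
      ∣ S ∣ + 0          ≡⟨ cong (∣ S ∣ +_) (∣⊥∣≡0 (order H)) ⟨
      ∣ S ∣ + ∣ ⊥ {order H} ∣ ≡⟨ ∣p++q∣≡∣p∣+∣q∣ S ⊥ ⟨
      ∣ S ++ ⊥ ∣         ≡⟨ ∣max∣ k (S ++ ⊥) (≤-trans k≤a a≤p) (col , max′) ⟩
      k * q              ∎
      where
      open ≡-Reasoning

      col : ColorableSet (G ∨ᴳ H) k (S ++ ⊥)
      col = subst (λ x → ColorableSet (G ∨ᴳ H) x (S ++ ⊥)) (+-identityʳ k)
        (∨ᴳ-colorable⁺ colS (colorable-⊥ H))

      max′ : ∀ U → S ++ ⊥ ⊆ U → ColorableSet (G ∨ᴳ H) k U → U ⊆ S ++ ⊥
      max′ U ⊆U colU with Vec.splitAt (order G) U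
      ... | S′ , T′ , refl with ∨ᴳ-colorable⁻ S′ T′ colU
      ...   | i , j , refl , colS′ , colT′ = ++-mono-⊆ {T = T′}
        (max S′ S⊆S′ (weaken (m≤m+n i j) colS′))
        (colorable-0⇒⊆ H (subst (λ x → ColorableSet H x T′) j≡0 colT′))
        where
        S⊆S′ : S ⊆ S′
        S⊆S′ = ++-⊆⁻ˡ {T = ⊥} {T′} ⊆U

        -- `S ⊆ S′` is coloured with `i` colours but needs all `i + j`, so none is left for the
        -- right side.
        j≡0 : j ≡ 0
        j≡0 = n≤0⇒n≡0 (+-cancelˡ-≤ i j 0 (subst (i + j ≤_) (sym (+-identityʳ i))
          (maximal-needs-all-colors G min k≤a maxS (restrict S⊆S′ colS′))))

-- Lets the argument for the left part of a join serve for the right part.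
∨ᴳ-comm : ∀ G H → (G ∨ᴳ H) ≅ (H ∨ᴳ G)
∨ᴳ-comm G H =
  mk↔ₛ′ (exchange G H) (exchange H G) (exchange-involutive G H) (exchange-involutive H G) ,
  λ u v → mk⇔
    (subst₂ (JoinAdj (Adj H) (Adj G))
      (sym (splitAt-exchange G H u)) (sym (splitAt-exchange G H v)) ∘ swap-adj)
    (swap-adj⁻ (splitAt (order G) u) (splitAt (order G) v) ∘
     subst₂ (JoinAdj (Adj H) (Adj G)) (splitAt-exchange G H u) (splitAt-exchange G H v))
  where
  exchange : ∀ G H → Vertex (G ∨ᴳ H) → Vertex (H ∨ᴳ G)
  exchange G H = joinFin (order H) (order G) ∘ swap ∘ splitAt (order G)

  splitAt-exchange : ∀ G H v → splitAt (order H) (exchange G H v) ≡ swap (splitAt (order G) v)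
  splitAt-exchange G H v = splitAt-join (order H) (order G) (swap (splitAt (order G) v))

  exchange-involutive : ∀ G H v → exchange G H (exchange H G v) ≡ v
  exchange-involutive G H v = trans
    (cong (joinFin (order H) (order G) ∘ swap) (splitAt-exchange H G v))
    (trans (cong (joinFin (order H) (order G)) (swap-involutive (splitAt (order H) v)))
      (join-splitAt (order H) (order G) v))

  swap-adj : ∀ {A B} {R : Rel A 0ℓ} {S : Rel B 0ℓ} {x y} →
             JoinAdj R S x y →
              JoinAdj S R (swap x) (swap y)
  swap-adj (left r)  = right r
  swap-adj (right s) = left s
  swap-adj cross     = cross′
  swap-adj cross′    = cross

  swap-adj⁻ : ∀ {A B} {R : Rel A 0ℓ} {S : Rel B 0ℓ} x y →
              JoinAdj S R (swap x) (swap y) → JoinAdj R S x y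
  swap-adj⁻ (inj₁ _) (inj₁ _) (right r) = left r
  swap-adj⁻ (inj₂ _) (inj₂ _) (left s)  = right s
  swap-adj⁻ (inj₁ _) (inj₂ _) cross′    = cross
  swap-adj⁻ (inj₂ _) (inj₁ _) cross     = cross′

-- The parameters `a` and `b` come from splitting a `p`-colouring of the whole join. Each is minimal
-- for its side, since a saving there would colour the join with fewer than `p` colours.
uniform-∨ᴳ⁻ : ∀ G H → 0 < order (G ∨ᴳ H) → Uniform (G ∨ᴳ H) p q →
              ∃₂ λ a b → a + b ≡ p × Uniform G a q × Uniform H b q
uniform-∨ᴳ⁻ G H 0<n u with ∨ᴳ-colorable⁻ G H ⊤ ⊤ (restrict (λ _ → ∈⊤) (colorable u))
... | a , b , refl , colG , colH = a , b , refl ,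
  uniform-∨ᴳ-left G H colG
    (λ {k} col → +-cancelʳ-≤ b a k (min (∨ᴳ-colorable⁺ G H col colH)))
    (m≤m+n a b) u ,
  uniform-∨ᴳ-left H G colH
    (λ {k} col → +-cancelˡ-≤ a b k (min (∨ᴳ-colorable⁺ G H colG col)))
    (m≤n+m b a) (uniform-≅ (G ∨ᴳ H) (H ∨ᴳ G) (∨ᴳ-comm G H) u)
  where
  min : ColorableSet (G ∨ᴳ H) k (⊤ {order G} ++ ⊤) → a + b ≤ k
  min col = uniform⇒minimal 0<n u (restrict (⊤⊆⊤++⊤ {order G}) col)

-- Complements and the induction over cographs

complement-cong : ∀ G H → G ≅ H → complement G ≅ complement H
complement-cong G H (f , adj) = f , λ u v → mk⇔
  (λ (u≢v , ¬uv) → u≢v ∘ to-injective , ¬uv ∘ Equivalence.from (adj u v))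
  (λ (fu≢fv , ¬uv) → fu≢fv ∘ cong to , ¬uv ∘ Equivalence.to (adj u v))
  where
  open Inverse f

  to-injective : Injective _≡_ _≡_ to
  to-injective eq = trans (sym (inverseʳ refl)) (trans (cong from eq) (inverseʳ refl))

complement-involutive : ∀ G → complement (complement G) ≅ G
complement-involutive G = ↔-id _ , λ u v → mk⇔
  (λ (u≢v , ¬¬uv) → decidable-stable (adj? G u v) λ ¬uv → ¬¬uv (u≢v , ¬uv))
  (λ uv → (λ u≡v → adj-irrefl G v (subst (λ w → Adj G w v) u≡v uv)) , λ (_ , ¬uv) → ¬uv uv)

splitAt-injective : ∀ m {n} → Injective _≡_ _≡_ (splitAt m {n})
splitAt-injective m {n} {u} {v} eq =
  trans (sym (join-splitAt m n u)) (trans (cong (joinFin m n) eq) (join-splitAt m n v))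

complement-∪ᴳ : ∀ G H → complement (G ∪ᴳ H) ≅ (complement G ∨ᴳ complement H)
complement-∪ᴳ G H = ↔-id _ , λ u v → mk⇔
  (λ (u≢v , ¬uv) → to (split u) (split v) (u≢v ∘ splitAt-injective (order G)) ¬uv)
  (λ uv → let su≢sv , ¬uv = from uv in su≢sv ∘ cong split , ¬uv)
  where
  split : Vertex (G ∪ᴳ H) → Vertex G ⊎ Vertex H
  split = splitAt (order G)

  to : ∀ x y → x ≢ y → ¬ Pointwise (Adj G) (Adj H) x y →
       JoinAdj (Adj (complement G)) (Adj (complement H)) x y
  to (inj₁ _) (inj₁ _) x≢y ¬xy = left (x≢y ∘ cong inj₁ , ¬xy ∘ inj₁)
  to (inj₁ _) (inj₂ _) x≢y ¬xy = cross
  to (inj₂ _) (inj₁ _) x≢y ¬xy = cross′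
  to (inj₂ _) (inj₂ _) x≢y ¬xy = right (x≢y ∘ cong inj₂ , ¬xy ∘ inj₂)

  from : ∀ {x y} → JoinAdj (Adj (complement G)) (Adj (complement H)) x y →
         x ≢ y × ¬ Pointwise (Adj G) (Adj H) x y
  from (left (a≢a′ , ¬aa′))  = a≢a′ ∘ inj₁-injective , λ { (inj₁ aa′) → ¬aa′ aa′ }
  from (right (b≢b′ , ¬bb′)) = b≢b′ ∘ inj₂-injective , λ { (inj₂ bb′) → ¬bb′ bb′ }
  from cross                 = (λ ()) , λ ()
  from cross′                = (λ ()) , λ ()

complement-∨ᴳ : ∀ G H → complement (G ∨ᴳ H) ≅ (complement G ∪ᴳ complement H)
complement-∨ᴳ G H = ↔-id _ , λ u v → mk⇔
  (λ (u≢v , ¬uv) → to (split u) (split v) (u≢v ∘ splitAt-injective (order G)) ¬uv)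
  (λ uv → let su≢sv , ¬uv = from uv in su≢sv ∘ cong split , ¬uv)
  where
  split : Vertex (G ∨ᴳ H) → Vertex G ⊎ Vertex H
  split = splitAt (order G)

  to : ∀ x y → x ≢ y → ¬ JoinAdj (Adj G) (Adj H) x y →
       Pointwise (Adj (complement G)) (Adj (complement H)) x y
  to (inj₁ _) (inj₁ _) x≢y ¬xy = inj₁ (x≢y ∘ cong inj₁ , ¬xy ∘ left)
  to (inj₁ _) (inj₂ _) x≢y ¬xy = contradiction cross ¬xy
  to (inj₂ _) (inj₁ _) x≢y ¬xy = contradiction cross′ ¬xy
  to (inj₂ _) (inj₂ _) x≢y ¬xy = inj₂ (x≢y ∘ cong inj₂ , ¬xy ∘ right)

  from : ∀ {x y} → Pointwise (Adj (complement G)) (Adj (complement H)) x y →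
         x ≢ y × ¬ JoinAdj (Adj G) (Adj H) x y
  from (inj₁ (a≢a′ , ¬aa′)) = a≢a′ ∘ inj₁-injective , λ { (left aa′) → ¬aa′ aa′ }
  from (inj₂ (b≢b′ , ¬bb′)) = b≢b′ ∘ inj₂-injective , λ { (right bb′) → ¬bb′ bb′ }

K₁≅complement-K₁ : K₁ ≅ complement K₁
K₁≅complement-K₁ = ↔-id _ , λ { zero zero → mk⇔ (λ ()) (λ (0≢0 , _) → 0≢0 refl) }

-- Nonemptiness pins down the parameters: the empty graph is uniform with `q = 0` for every `p`.
0<order : ∀ {G} → Cograph G → 0 < order G
0<order k₁            = z<s
0<order (union {G} {H} cG _) = ≤-trans (0<order cG) (m≤m+n (order G) (order H))
0<order (join {G} {H} cG _) = ≤-trans (0<order cG) (m≤m+n (order G) (order H))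
0<order (iso (f , _) cG) = subst (0 <_) (↔⇒≡ f) (0<order cG)

cograph-complement : ∀ {G} → Cograph G → Cograph (complement G)
cograph-complement k₁ = iso {K₁} K₁≅complement-K₁ k₁
cograph-complement (union {G} {H} cG cH) =
  iso (≅-sym (complement (G ∪ᴳ H)) (complement G ∨ᴳ complement H) (complement-∪ᴳ G H))
    (join (cograph-complement cG) (cograph-complement cH))
cograph-complement (join {G} {H} cG cH) =
  iso (≅-sym (complement (G ∨ᴳ H)) (complement G ∪ᴳ complement H) (complement-∨ᴳ G H))
    (union (cograph-complement cG) (cograph-complement cH))
cograph-complement (iso {G} {H} G≅H cG) =
  iso (complement-cong G H G≅H) (cograph-complement cG)

uniform-complement : ∀ {G} → Cograph G → Uniform G p q → Uniform (complement G) q p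
uniform-complement {p} {q} k₁ u
  -- The order 1 is `p * q`, so both parameters are 1 and the exchange is trivial.
  with m*n≡1⇒m≡1 p q (sym (order≡ u)) | m*n≡1⇒n≡1 p q (sym (order≡ u))
... | refl | refl = uniform-≅ K₁ (complement K₁) K₁≅complement-K₁ u
uniform-complement {p} cGH@(union {G} {H} cG cH) u =
  let r , s , r+s≡q , uG , uH = uniform-∪ᴳ⁻ G H (0<order cGH) u in
  uniform-≅ (complement G ∨ᴳ complement H) (complement (G ∪ᴳ H))
    (≅-sym (complement (G ∪ᴳ H)) (complement G ∨ᴳ complement H) (complement-∪ᴳ G H))
    (subst (λ x → Uniform (complement G ∨ᴳ complement H) x p) r+s≡q
      (uniform-∨ᴳ⁺ (complement G) (complement H)
        (uniform-complement cG uG) (uniform-complement cH uH)))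
uniform-complement {q = q} cGH@(join {G} {H} cG cH) u =
  let a , b , a+b≡p , uG , uH = uniform-∨ᴳ⁻ G H (0<order cGH) u in
  uniform-≅ (complement G ∪ᴳ complement H) (complement (G ∨ᴳ H))
    (≅-sym (complement (G ∨ᴳ H)) (complement G ∪ᴳ complement H) (complement-∨ᴳ G H))
    (subst (Uniform (complement G ∪ᴳ complement H) q) a+b≡p
      (uniform-∪ᴳ⁺ (complement G) (complement H)
        (uniform-complement cG uG) (uniform-complement cH uH)))
uniform-complement (iso {G} {H} G≅H cG) u =
  uniform-≅ (complement G) (complement H) (complement-cong G H G≅H)
    (uniform-complement cG (uniform-≅ H G (≅-sym G H G≅H) u))

theorem9 : (G : Graph) → Cograph G → WellEquiHued G ⇔ WellEquiHued (complement G)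
theorem9 G cG = mk⇔ to from
  where
  cḠ : Cograph (complement G)
  cḠ = cograph-complement cG

  to : WellEquiHued G → WellEquiHued (complement G)
  to weh with wellEquiHued⇒uniform G (0<order cG) weh
  ... | p , q , u = uniform⇒wellEquiHued (0<order cḠ) (uniform-complement cG u)

  from : WellEquiHued (complement G) → WellEquiHued G
  from weh with wellEquiHued⇒uniform (complement G) (0<order cḠ) weh
  -- The exchange is applied to the complement, again a cograph, and the double complement is
  -- identified with `G`.
  ... | p , q , u = uniform⇒wellEquiHued (0<order cG)
    (uniform-≅ (complement (complement G)) G (complement-involutive G) (uniform-complement cḠ u))
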